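{- Let $G=(V,E,w)$ be a finite connected graph with $|V|=n\ge2$ and weights $w:E\to\mathbb{R}_{>0}$. Let $H$ be an arbitrary rooted binary hierarchy on $V$. There exists a rooted binary hierarchy $T$ on $V$, all of whose clusters induce connected subgraphs of $G$, such that for every edge $xy\in E$, $$|C_T(x,y)|\le|C_H(x,y)|.$$ Consequently, $$\operatorname{cost}_D^-(T)\le\operatorname{cost}_D^-(H)\quad\text{and}\quad\operatorname{cost}_D(T)\le\operatorname{cost}_D(H).$$
   Context: A rooted binary hierarchy $T$ on $V$ is a rooted tree whose leaves are the vertices of $V$ and whose internal nodes have exactly two children; each node is identified with the set of leaves in its subtree (a cluster), and $C_T(x,y)$ is the cluster of the lowest common ancestor of $x,y$. The standard and shifted Dasgupta objectives are $\operatorname{cost}_D(T)=\sum_{xy\in E}w_{xy}|C_T(x,y)|$ and $\operatorname{cost}_D^-(T)=\sum_{xy\in E}w_{xy}(|C_T(x,y)|-1)$. -}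

module Defs where

open import Algebra.Bundles.Raw using (RawMonoid)
open import Data.Bool.Base using (if_then_else_)
open import Data.Fin.Base using (Fin; _<_)
open import Data.Fin.Properties using (_<?_)
open import Data.Fin.Subset using (Subset; _∈_; _∪_; ⁅_⁆; ∣_∣)
open import Data.Fin.Subset.Properties using (_∈?_)
open import Data.List.Base using (List; allFin; cartesianProduct; filter; foldr; map)
open import Data.List.Relation.Binary.Permutation.Propositional using (_↭_)
open import Data.Nat.Base as ℕ using (ℕ; _∸_; _⊔_)
import Data.Nat.Properties as ℕ
open import Data.Product.Base using (∃-syntax; _×_; _,_)
open import Data.Rational.Base as ℚ using (ℚ; 0ℚ; ½)
import Data.Rational.Properties as ℚ
open import Data.Rational.Solver using (module +-*-Solver)
open import Data.Tree.Binary using (Tree; leaf; node; module Leaves)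
open import Data.Unit.Base using (⊤)
open import Level using (0ℓ)
open import Relation.Binary.Core using (Rel)
open import Relation.Binary.Definitions using (Decidable; Irreflexive; Symmetric)
open import Relation.Binary.Construct.Closure.ReflexiveTransitive using (Star)
open import Relation.Binary.PropositionalEquality using (_≡_; refl; sym; trans; cong; subst)
open import Relation.Nullary.Decidable using (does; _×-dec_)

-- Real numbers as Cauchy sequences of rationals. Weights are only ever added,
-- multiplied by natural numbers and compared, so no other operation is defined.

record ℝ : Set where
  field
    seq    : ℕ → ℚ
    cauchy : ∀ ε → 0ℚ ℚ.< ε →
             ∃[ N ] (∀ m n → N ℕ.≤ m → N ℕ.≤ n → ℚ.∣ seq m ℚ.- seq n ∣ ℚ.< ε)

open ℝ public

infix 4 _≃_ _≤ᵣ_ _<ᵣ_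
infixl 6 _+ᵣ_

_≃_ : Rel ℝ 0ℓ
x ≃ y = ∀ ε → 0ℚ ℚ.< ε →
        ∃[ N ] (∀ n → N ℕ.≤ n → ℚ.∣ seq x n ℚ.- seq y n ∣ ℚ.< ε)

_≤ᵣ_ : Rel ℝ 0ℓ
x ≤ᵣ y = ∀ ε → 0ℚ ℚ.< ε →
         ∃[ N ] (∀ n → N ℕ.≤ n → seq x n ℚ.≤ seq y n ℚ.+ ε)

_<ᵣ_ : Rel ℝ 0ℓ
x <ᵣ y = ∃[ ε ] 0ℚ ℚ.< ε ×
         (∃[ N ] (∀ n → N ℕ.≤ n → seq x n ℚ.+ ε ℚ.≤ seq y n))

0ᵣ : ℝ
0ᵣ = record { seq = λ _ → 0ℚ ; cauchy = λ _ 0<ε → 0 , λ _ _ _ _ → 0<ε }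

private
  half+half : ∀ ε → ½ ℚ.* ε ℚ.+ ½ ℚ.* ε ≡ ε
  half+half ε = trans (sym (ℚ.*-distribʳ-+ ε ½ ½)) (ℚ.*-identityˡ ε)

  0<half : ∀ ε → 0ℚ ℚ.< ε → 0ℚ ℚ.< ½ ℚ.* ε
  0<half ε 0<ε = subst (ℚ._< ½ ℚ.* ε) (ℚ.*-zeroʳ ½) (ℚ.*-monoʳ-<-pos ½ 0<ε)

  interchange : ∀ a b c d → (a ℚ.+ b) ℚ.- (c ℚ.+ d) ≡ (a ℚ.- c) ℚ.+ (b ℚ.- d)
  interchange = solve 4 (λ a b c d →
    ((a :+ b) :- (c :+ d)) := ((a :- c) :+ (b :- d))) refl
    where open +-*-Solver

_+ᵣ_ : ℝ → ℝ → ℝ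
x +ᵣ y = record { seq = λ n → seq x n ℚ.+ seq y n ; cauchy = cauchy-+ }
  where
  cauchy-+ : ∀ ε → 0ℚ ℚ.< ε → ∃[ N ] (∀ m n → N ℕ.≤ m → N ℕ.≤ n →
             ℚ.∣ (seq x m ℚ.+ seq y m) ℚ.- (seq x n ℚ.+ seq y n) ∣ ℚ.< ε)
  cauchy-+ ε 0<ε
    with M , x-close ← cauchy x (½ ℚ.* ε) (0<half ε 0<ε)
       | N , y-close ← cauchy y (½ ℚ.* ε) (0<half ε 0<ε)
    = M ⊔ N , λ m n ≤m ≤n → begin-strict
      ℚ.∣ (seq x m ℚ.+ seq y m) ℚ.- (seq x n ℚ.+ seq y n) ∣
        ≡⟨ cong ℚ.∣_∣ (interchange (seq x m) (seq y m) (seq x n) (seq y n)) ⟩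
      ℚ.∣ (seq x m ℚ.- seq x n) ℚ.+ (seq y m ℚ.- seq y n) ∣
        ≤⟨ ℚ.∣p+q∣≤∣p∣+∣q∣ (seq x m ℚ.- seq x n) (seq y m ℚ.- seq y n) ⟩
      ℚ.∣ seq x m ℚ.- seq x n ∣ ℚ.+ ℚ.∣ seq y m ℚ.- seq y n ∣
        <⟨ ℚ.+-mono-< (x-close m n (ℕ.m⊔n≤o⇒m≤o M N ≤m) (ℕ.m⊔n≤o⇒m≤o M N ≤n))
                      (y-close m n (ℕ.m⊔n≤o⇒n≤o M N ≤m) (ℕ.m⊔n≤o⇒n≤o M N ≤n)) ⟩
      ½ ℚ.* ε ℚ.+ ½ ℚ.* ε
        ≡⟨ half+half ε ⟩
      ε ∎
    where open ℚ.≤-Reasoning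

+ᵣ-rawMonoid : RawMonoid 0ℓ 0ℓ
+ᵣ-rawMonoid = record { Carrier = ℝ ; _≈_ = _≃_ ; _∙_ = _+ᵣ_ ; ε = 0ᵣ }

open import Algebra.Definitions.RawMonoid +ᵣ-rawMonoid public
  using () renaming (_×_ to _·_)

-- Finite simple graphs on n vertices. The weight function is total for
-- convenience; its values off the edges are unconstrained and never used.

record WeightedGraph (n : ℕ) : Set₁ where
  field
    Adj        : Rel (Fin n) 0ℓ
    adj?       : Decidable Adj
    adj-sym    : Symmetric Adj
    adj-irrefl : Irreflexive _≡_ Adj
    w          : Fin n → Fin n → ℝ
    w-sym      : ∀ {x y} → Adj x y → w x y ≃ w y x
    w-pos      : ∀ {x y} → Adj x y → 0ᵣ <ᵣ w x y

  -- Each undirected edge is listed once, smaller endpoint first.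
  edges : List (Fin n × Fin n)
  edges = filter (λ (x , y) → (x <? y) ×-dec adj? x y)
                 (cartesianProduct (allFin n) (allFin n))

  ∑ᴱ : (Fin n → Fin n → ℝ) → ℝ
  ∑ᴱ f = foldr _+ᵣ_ 0ᵣ (map (λ (x , y) → f x y) edges)

  Connected : Set
  Connected = ∀ x y → Star Adj x y

  Induced : Subset n → Rel (Fin n) 0ℓ
  Induced S x y = x ∈ S × y ∈ S × Adj x y

  InducesConnected : Subset n → Set
  InducesConnected S = ∀ {x y} → x ∈ S → y ∈ S → Star (Induced S) x y

BinTree : ℕ → Set
BinTree n = Tree ⊤ (Fin n)

cluster : ∀ {n} → BinTree n → Subset n
cluster (leaf v)     = ⁅ v ⁆
cluster (node l _ r) = cluster l ∪ cluster r

-- s ⊑ t: s is the subtree of t rooted at some node of t.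
infix 4 _⊑_

data _⊑_ {n : ℕ} (s : BinTree n) : BinTree n → Set where
  here  : s ⊑ s
  left  : ∀ {l m r} → s ⊑ l → s ⊑ node l m r
  right : ∀ {l m r} → s ⊑ r → s ⊑ node l m r

-- The subtree rooted at the lowest common ancestor of x and y, for leaves x and
-- y of a tree without repeated leaves.
lca : ∀ {n} → BinTree n → Fin n → Fin n → BinTree n
lca t@(leaf _)     x y = t
lca t@(node l _ r) x y =
  if does ((x ∈? cluster l) ×-dec (y ∈? cluster l)) then lca l x y else
  if does ((x ∈? cluster r) ×-dec (y ∈? cluster r)) then lca r x y else
  t

record Hierarchy (n : ℕ) : Set where
  field
    tree   : BinTree n
    leaves : Leaves.toList tree ↭ allFin n   -- every vertex labels exactly one leaf

  C : Fin n → Fin n → Subset n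
  C x y = cluster (lca tree x y)

module _ {n : ℕ} (G : WeightedGraph n) (T : Hierarchy n) where
  open WeightedGraph G
  open Hierarchy T

  ClustersConnected : Set
  ClustersConnected = ∀ {s} → s ⊑ tree → InducesConnected (cluster s)

  costD : ℝ
  costD = ∑ᴱ λ x y → ∣ C x y ∣ · w x y

  -- Truncated subtraction is exact here, clusters being nonempty.
  costD⁻ : ℝ
  costD⁻ = ∑ᴱ λ x y → (∣ C x y ∣ ∸ 1) · w x y

{-# OPTIONS --safe #-}
module Submission where

-- The hierarchy T is built from H bottom up. To every subtree h of H is attached
-- a forest: one binary tree for each connected component of the subgraph induced
-- by the leaves of h, in which every cluster is connected. A leaf gives a single
-- one-leaf tree. At a node with children l and r, the trees of the two forests
-- are merged, two at a time and only when an edge joins them, until no edge joins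
-- two different trees; a union of two connected sets joined by an edge is
-- connected, so clusters stay connected.
--
-- The sizes do not grow: an edge inside one tree of the old forests keeps its
-- lowest common ancestor, whereas an edge joining two different trees of the old
-- forests must run between l and r, as no edge joins two trees of the same
-- forest. Its lowest common ancestor in H is therefore the whole node, which
-- contains every cluster of the new forest (the record Refines, and
-- forest-refines).
--
-- As no edge joins two trees of the forest of H itself (forest-separated) and G
-- is connected, that forest is a single tree (separated⇒singleton), and it is T.
-- The two cost inequalities hold summand by summand, the weights being positive.

open import Defs
open import Data.Nat.Base using (ℕ; _≤_)
open import Data.Fin.Base using (Fin)
open import Data.Fin.Subset using (∣_∣)
open import Data.Product.Base using (_×_; ∃-syntax)

open import Data.Empty using (⊥-elim)
open import Data.Fin.Base using (zero; _<_)
open import Data.Fin.Properties using (any?; _<?_)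
open import Data.Fin.Subset using (Subset; _∈_; _⊆_; _∪_)
open import Data.Fin.Subset.Properties
  using (_∈?_; p⊆q⇒∣p∣≤∣q∣; p⊆p∪q; q⊆p∪q; x∈p∪q⁻; x∈⁅y⁆⇒x≡y; x∈⁅x⁆)
open import Data.List.Base
  using (List; []; _∷_; [_]; _++_; allFin; cartesianProduct; concatMap; foldr; map)
import Data.List.Membership.Propositional as L
open import Data.List.Membership.Propositional.Properties
  using (∈-++⁺ˡ; ∈-++⁺ʳ; ∈-++⁻; ∈-allFin)
open import Data.List.Properties using (++-assoc; ++-identityʳ)
open import Data.List.Relation.Binary.Disjoint.Propositional using (Disjoint)
open import Data.List.Relation.Binary.Permutation.Propositional
  using (_↭_; ↭-refl; ↭-reflexive; ↭-sym; ↭-trans; ↭⇒↭ₛ)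
open import Data.List.Relation.Binary.Permutation.Propositional.Properties
  using (∈-resp-↭; shifts; ++⁺; ++⁺ˡ)
import Data.List.Relation.Binary.Permutation.Setoid.Properties as Permutation
open import Data.List.Relation.Unary.All as All using (All; []; _∷_)
open import Data.List.Relation.Unary.All.Properties using (all-filter; ++⁻ˡ; ++⁻ʳ)
open import Data.List.Relation.Unary.AllPairs as AllPairs using (AllPairs; []; _∷_)
import Data.List.Relation.Unary.AllPairs.Properties as AllPairs
open import Data.List.Relation.Unary.Any using (here; there)
open import Data.List.Relation.Unary.Unique.Propositional using (Unique)
open import Data.List.Relation.Unary.Unique.Propositional.Properties using (allFin⁺)
open import Data.Nat.Base as ℕ using (suc; z≤n; s≤s; _⊔_; _∸_)
import Data.Nat.Properties as ℕ
open import Data.Product.Base using (_,_; proj₁; proj₂)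
open import Data.Rational.Base as ℚ using (ℚ; 0ℚ)
import Data.Rational.Properties as ℚ
open import Data.Sum.Base as Sum using (_⊎_; inj₁; inj₂)
open import Data.Tree.Binary using (leaf; node; module Leaves)
open import Data.Unit.Base using (tt)
open import Function.Base using (_∘_; id)
open import Level using (0ℓ)
open import Relation.Binary.Core using (Rel)
open import Relation.Binary.Construct.Closure.ReflexiveTransitive as Star
  using (Star; ε; _◅_; _◅◅_)
open import Relation.Binary.Definitions using (Decidable; Symmetric)
open import Relation.Binary.PropositionalEquality
  using (_≡_; refl; sym; trans; cong; subst; setoid)
open import Relation.Nullary.Decidable using (yes; no; _×-dec_; dec-true; dec-false)
open import Relation.Nullary.Negation.Core using (¬_)
open import Relation.Unary using (Pred)

-- Lists without repetition

unique-++⁻ : ∀ {A : Set} (xs : List A) {ys} → Unique (xs ++ ys) →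
             Unique xs × Unique ys × Disjoint xs ys
unique-++⁻ []       ys! = [] , ys! , λ { (() , _) }
unique-++⁻ (x ∷ xs) (x∉ ∷ xs!) with unique-++⁻ xs xs!
... | xs₁! , ys! , xs#ys = ++⁻ˡ xs x∉ ∷ xs₁! , ys! , λ
  { (here refl , v∈ys) → All.lookup (++⁻ʳ xs x∉) v∈ys refl
  ; (there v∈xs , v∈ys) → xs#ys (v∈xs , v∈ys) }

↭-allFin⇒unique : ∀ {n} {xs : List (Fin n)} → xs ↭ allFin n → Unique xs
↭-allFin⇒unique {n} xs↭ =
  Permutation.Unique-resp-↭ (setoid (Fin n)) (↭⇒↭ₛ (↭-sym xs↭)) (allFin⁺ n)

-- Leaves, clusters and lowest common ancestors

module _ {n : ℕ} where

  leaves-node : (l r : BinTree n) →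
                Leaves.toList (node l tt r) ≡ Leaves.toList l ++ Leaves.toList r
  leaves-node l r = toDiffList-++ l _
    where
    toDiffList-++ : (t : BinTree n) (xs : List (Fin n)) →
                    Leaves.toDiffList t xs ≡ Leaves.toList t ++ xs
    toDiffList-++ (leaf v)     xs = refl
    toDiffList-++ (node l _ r) xs =
      trans (toDiffList-++ l _)
     (trans (cong (Leaves.toList l ++_) (toDiffList-++ r xs))
     (trans (sym (++-assoc (Leaves.toList l) (Leaves.toList r) xs))
            (cong (_++ xs) (sym (toDiffList-++ l _)))))

  ∈-leaves⇒∈-cluster : (t : BinTree n) {x : Fin n} →
                       x L.∈ Leaves.toList t → x ∈ cluster t
  ∈-leaves⇒∈-cluster (leaf v)     (here refl) = x∈⁅x⁆ v
  ∈-leaves⇒∈-cluster (node l _ r) {x} x∈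
    with ∈-++⁻ (Leaves.toList l) (subst (x L.∈_) (leaves-node l r) x∈)
  ... | inj₁ x∈l = p⊆p∪q (cluster r) (∈-leaves⇒∈-cluster l x∈l)
  ... | inj₂ x∈r = q⊆p∪q (cluster l) (cluster r) (∈-leaves⇒∈-cluster r x∈r)

  ∈-cluster⇒∈-leaves : (t : BinTree n) {x : Fin n} →
                       x ∈ cluster t → x L.∈ Leaves.toList t
  ∈-cluster⇒∈-leaves (leaf v)     x∈ = here (x∈⁅y⁆⇒x≡y v x∈)
  ∈-cluster⇒∈-leaves (node l _ r) {x} x∈ =
    subst (x L.∈_) (sym (leaves-node l r)) (case (x∈p∪q⁻ (cluster l) (cluster r) x∈))
    where
    case : x ∈ cluster l ⊎ x ∈ cluster r → x L.∈ Leaves.toList l ++ Leaves.toList r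
    case (inj₁ x∈l) = ∈-++⁺ˡ (∈-cluster⇒∈-leaves l x∈l)
    case (inj₂ x∈r) = ∈-++⁺ʳ (Leaves.toList l) (∈-cluster⇒∈-leaves r x∈r)

  cluster-nonempty : (t : BinTree n) → ∃[ x ] x ∈ cluster t
  cluster-nonempty (leaf v)     = v , x∈⁅x⁆ v
  cluster-nonempty (node l _ r) with x , x∈l ← cluster-nonempty l =
    x , p⊆p∪q (cluster r) x∈l

  DisjointSubsets : Rel (Subset n) 0ℓ
  DisjointSubsets p q = ∀ {x} → x ∈ p → ¬ x ∈ q

  unique-node⁻ : (l r : BinTree n) → Unique (Leaves.toList (node l tt r)) →
                 Unique (Leaves.toList l) × Unique (Leaves.toList r) ×
                 DisjointSubsets (cluster l) (cluster r)
  unique-node⁻ l r lr!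
    with l! , r! , l#r ← unique-++⁻ (Leaves.toList l) (subst Unique (leaves-node l r) lr!)
    = l! , r! , λ x∈l x∈r → l#r (∈-cluster⇒∈-leaves l x∈l , ∈-cluster⇒∈-leaves r x∈r)

  module _ (l r : BinTree n) {x y : Fin n} where

    lca-left : x ∈ cluster l → y ∈ cluster l → lca (node l tt r) x y ≡ lca l x y
    lca-left x∈l y∈l
      rewrite dec-true ((x ∈? cluster l) ×-dec (y ∈? cluster l)) (x∈l , y∈l) = refl

    lca-right : ¬ (x ∈ cluster l × y ∈ cluster l) → x ∈ cluster r → y ∈ cluster r →
                lca (node l tt r) x y ≡ lca r x y
    lca-right ∉l x∈r y∈r
      rewrite dec-false ((x ∈? cluster l) ×-dec (y ∈? cluster l)) ∉l
            | dec-true ((x ∈? cluster r) ×-dec (y ∈? cluster r)) (x∈r , y∈r) = refl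

    lca-root : ¬ (x ∈ cluster l × y ∈ cluster l) → ¬ (x ∈ cluster r × y ∈ cluster r) →
               lca (node l tt r) x y ≡ node l tt r
    lca-root ∉l ∉r
      rewrite dec-false ((x ∈? cluster l) ×-dec (y ∈? cluster l)) ∉l
            | dec-false ((x ∈? cluster r) ×-dec (y ∈? cluster r)) ∉r = refl

-- Forests and their leaves

Forest : ℕ → Set
Forest n = List (BinTree n)

module _ {n : ℕ} where

  leavesᶠ : Forest n → List (Fin n)
  leavesᶠ = concatMap Leaves.toList

  ∈-leavesᶠ⁻ : ∀ (F : Forest n) {x} → x L.∈ leavesᶠ F → ∃[ t ] t L.∈ F × x ∈ cluster t
  ∈-leavesᶠ⁻ (t ∷ F) x∈ with ∈-++⁻ (Leaves.toList t) x∈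
  ... | inj₁ x∈t = t , here refl , ∈-leaves⇒∈-cluster t x∈t
  ... | inj₂ x∈F with u , u∈F , x∈u ← ∈-leavesᶠ⁻ F x∈F = u , there u∈F , x∈u

module _ {n : ℕ} (G : WeightedGraph n) where
  open WeightedGraph G

  -- Connected sets and touching trees

  ∪-connected : (p q : Subset n) → InducesConnected p → InducesConnected q →
                ∀ {a b} → a ∈ p → b ∈ q → Adj a b → InducesConnected (p ∪ q)
  ∪-connected p q p-conn q-conn {a} {b} a∈p b∈q ab x∈ y∈ =
    join (x∈p∪q⁻ p q x∈) (x∈p∪q⁻ p q y∈)
    where
    pathˡ : ∀ {x y} → x ∈ p → y ∈ p → Star (Induced (p ∪ q)) x y
    pathˡ x∈p y∈p = Star.map
      (λ (u∈ , v∈ , uv) → p⊆p∪q q u∈ , p⊆p∪q q v∈ , uv) (p-conn x∈p y∈p)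

    pathʳ : ∀ {x y} → x ∈ q → y ∈ q → Star (Induced (p ∪ q)) x y
    pathʳ x∈q y∈q = Star.map
      (λ (u∈ , v∈ , uv) → q⊆p∪q p q u∈ , q⊆p∪q p q v∈ , uv) (q-conn x∈q y∈q)

    a→b : Induced (p ∪ q) a b
    a→b = p⊆p∪q q a∈p , q⊆p∪q p q b∈q , ab

    b→a : Induced (p ∪ q) b a
    b→a = q⊆p∪q p q b∈q , p⊆p∪q q a∈p , adj-sym ab

    join : ∀ {x y} → x ∈ p ⊎ x ∈ q → y ∈ p ⊎ y ∈ q → Star (Induced (p ∪ q)) x y
    join (inj₁ x∈p) (inj₁ y∈p) = pathˡ x∈p y∈p
    join (inj₁ x∈p) (inj₂ y∈q) = pathˡ x∈p a∈p ◅◅ a→b ◅ pathʳ b∈q y∈q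
    join (inj₂ x∈q) (inj₁ y∈p) = pathʳ x∈q b∈q ◅◅ b→a ◅ pathˡ a∈p y∈p
    join (inj₂ x∈q) (inj₂ y∈q) = pathʳ x∈q y∈q

  -- Every cluster of the tree, whose leaves need not be all vertices, induces a
  -- connected subgraph.
  AllClustersConnected : Pred (BinTree n) 0ℓ
  AllClustersConnected t = ∀ {s} → s ⊑ t → InducesConnected (cluster s)

  -- Some edge of G joins a leaf of s to a leaf of t.
  Touching : Rel (BinTree n) 0ℓ
  Touching s t = ∃[ x ] ∃[ y ] x ∈ cluster s × y ∈ cluster t × Adj x y

  touching? : Decidable Touching
  touching? s t = any? λ x → any? λ y →
    (x ∈? cluster s) ×-dec ((y ∈? cluster t) ×-dec adj? x y)

  Separated : Rel (BinTree n) 0ℓ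
  Separated s t = ¬ Touching s t

  separated-sym : Symmetric Separated
  separated-sym s∥t (x , y , x∈t , y∈s , xy) = s∥t (y , x , y∈s , x∈t , adj-sym xy)

  separated-node : ∀ {u s t} → Separated u s → Separated u t → Separated u (node s tt t)
  separated-node {s = s} {t} u∥s u∥t (x , y , x∈u , y∈st , xy)
    with x∈p∪q⁻ (cluster s) (cluster t) y∈st
  ... | inj₁ y∈s = u∥s (x , y , x∈u , y∈s , xy)
  ... | inj₂ y∈t = u∥t (x , y , x∈u , y∈t , xy)

  -- The forest of connected components

  -- Adds a tree to a forest, merging it with every tree that it touches. If no
  -- two trees of the forest touch, the same holds afterwards: a tree that is
  -- passed over touches neither the growing tree nor the trees it absorbs later.
  graft : BinTree n → Forest n → Forest n
  graft t []      = t ∷ []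
  graft t (s ∷ F) with touching? t s
  ... | yes _ = graft (node t tt s) F
  ... | no  _ = s ∷ graft t F

  -- If no leaf of h is repeated, the trees of forest h have as clusters the
  -- connected components of the subgraph induced by the leaves of h.
  forest : BinTree n → Forest n
  forest (leaf v)     = leaf v ∷ []
  forest (node l _ r) = foldr graft (forest r) (forest l)

  graft-leaves : ∀ t F → leavesᶠ (graft t F) ↭ Leaves.toList t ++ leavesᶠ F
  graft-leaves t []      = ↭-refl
  graft-leaves t (s ∷ F) with touching? t s
  ... | yes _ = ↭-trans (graft-leaves (node t tt s) F) (↭-reflexive
    (trans (cong (_++ leavesᶠ F) (leaves-node t s))
           (++-assoc (Leaves.toList t) (Leaves.toList s) (leavesᶠ F))))
  ... | no  _ = ↭-trans (++⁺ˡ (Leaves.toList s) (graft-leaves t F))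
                        (shifts (Leaves.toList s) (Leaves.toList t))

  foldr-graft-leaves : ∀ F F′ → leavesᶠ (foldr graft F′ F) ↭ leavesᶠ F ++ leavesᶠ F′
  foldr-graft-leaves []      F′ = ↭-refl
  foldr-graft-leaves (t ∷ F) F′ =
    ↭-trans (graft-leaves t (foldr graft F′ F))
   (↭-trans (++⁺ˡ (Leaves.toList t) (foldr-graft-leaves F F′))
            (↭-reflexive (sym (++-assoc (Leaves.toList t) (leavesᶠ F) (leavesᶠ F′)))))

  forest-leaves : ∀ h → leavesᶠ (forest h) ↭ Leaves.toList h
  forest-leaves (leaf v)     = ↭-refl
  forest-leaves (node l _ r) =
    ↭-trans (foldr-graft-leaves (forest l) (forest r))
   (↭-trans (++⁺ (forest-leaves l) (forest-leaves r))
            (↭-reflexive (sym (leaves-node l r))))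

  -- Invariants of grafting

  graft-All : {P : Pred (BinTree n) 0ℓ} → (∀ {s t} → P s → P t → P (node s tt t)) →
              ∀ {t F} → P t → All P F → All P (graft t F)
  graft-All P-node {F = []}        Pt []        = Pt ∷ []
  graft-All P-node {t} {F = s ∷ F} Pt (Ps ∷ PF) with touching? t s
  ... | yes _ = graft-All P-node (P-node Pt Ps) PF
  ... | no  _ = Ps ∷ graft-All P-node Pt PF

  graft-separated : ∀ t {F} → AllPairs Separated F → AllPairs Separated (graft t F)
  graft-separated t {[]}    []         = [] ∷ []
  graft-separated t {s ∷ F} (s∥F ∷ F∥) with touching? t s
  ... | yes _   = graft-separated (node t tt s) F∥
  ... | no  t∥s =
    graft-All (λ {a} {b} → separated-node {s} {a} {b}) (separated-sym {t} {s} t∥s) s∥F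
    ∷ graft-separated t F∥

  forest-separated : ∀ h → AllPairs Separated (forest h)
  forest-separated (leaf v)     = [] ∷ []
  forest-separated (node l _ r) = go (forest l)
    where
    go : ∀ F → AllPairs Separated (foldr graft (forest r) F)
    go []      = forest-separated r
    go (t ∷ F) = graft-separated t (go F)

  -- A property P of trees survives grafting when the trees involved are pairwise
  -- related by a symmetric relation R that is inherited by mergers, and when P
  -- passes to the merger of two touching trees that are related by R.
  module _ {P : Pred (BinTree n) 0ℓ} {R : Rel (BinTree n) 0ℓ} (R-sym : Symmetric R)
    (R-node : ∀ {u s t} → R u s → R u t → R u (node s tt t))
    (P-node : ∀ {s t} → Touching s t → R s t → P s → P t → P (node s tt t)) where

    graft-invariant : ∀ {t F} → P t → All P F → All (R t) F → AllPairs R F →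
                      All P (graft t F) × AllPairs R (graft t F)
    graft-invariant {F = []}    Pt []        []        []        = Pt ∷ [] , [] ∷ []
    graft-invariant {t} {s ∷ F} Pt (Ps ∷ PF) (Rts ∷ RtF) (RsF ∷ RF) with touching? t s
    ... | yes ts = graft-invariant (P-node ts Rts Pt Ps) PF
      (All.zipWith (λ (Rtu , Rsu) → R-sym (R-node (R-sym Rtu) (R-sym Rsu))) (RtF , RsF)) RF
    ... | no  _  with PF′ , RF′ ← graft-invariant Pt PF RtF RF =
      Ps ∷ PF′ , graft-All R-node (R-sym Rts) RsF ∷ RF′

    foldr-graft-invariant : ∀ F {F′} → All P F → All P F′ → AllPairs R (F ++ F′) →
                            All P (foldr graft F′ F) × AllPairs R (foldr graft F′ F)
    foldr-graft-invariant []      []        PF′ RF′         = PF′ , RF′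
    foldr-graft-invariant (t ∷ F) {F′} (Pt ∷ PF) PF′ (RtFF′ ∷ RFF′)
      with P-fold , R-fold ← foldr-graft-invariant F PF PF′ RFF′
      = graft-invariant Pt P-fold (Rt-fold F RtFF′) R-fold
      where
      Rt-fold : ∀ F → All (R t) (F ++ F′) → All (R t) (foldr graft F′ F)
      Rt-fold []      RtF′        = RtF′
      Rt-fold (s ∷ F) (Rts ∷ RtF) = graft-All R-node Rts (Rt-fold F RtF)

  -- Comparison with the given hierarchy

  -- The leaves of t are leaves of h, all clusters of t are connected, and the
  -- lowest common ancestor of the ends of an edge inside t has at most as many
  -- leaves in t as in h.
  record Refines (h t : BinTree n) : Set where
    field
      connected : AllClustersConnected t
      inside    : cluster t ⊆ cluster h
      lca-≤     : ∀ {x y} → Adj x y → x ∈ cluster t → y ∈ cluster t →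
                  ∣ cluster (lca t x y) ∣ ≤ ∣ cluster (lca h x y) ∣

  open Refines

  module _ (l r : BinTree n) where

    -- One end lies below l and the other below r.
    Across : Rel (Fin n) 0ℓ
    Across x y = (x ∈ cluster l × y ∈ cluster r) ⊎ (x ∈ cluster r × y ∈ cluster l)

    across-sym : Symmetric Across
    across-sym (inj₁ (x∈l , y∈r)) = inj₂ (y∈r , x∈l)
    across-sym (inj₂ (x∈r , y∈l)) = inj₁ (y∈l , x∈r)

    -- Every edge between s and t runs between the two children l and r.
    record JoinedAcross (s t : BinTree n) : Set where
      constructor joined
      field across : ∀ {x y} → Adj x y → x ∈ cluster s → y ∈ cluster t → Across x y

    open JoinedAcross

    joinedAcross-sym : Symmetric JoinedAcross
    joinedAcross-sym st = joined λ xy x∈t y∈s →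
      across-sym (across st (adj-sym xy) y∈s x∈t)

    joinedAcross-node : ∀ {u s t} → JoinedAcross u s → JoinedAcross u t →
                        JoinedAcross u (node s tt t)
    joinedAcross-node {s = s} {t} us ut = joined λ xy x∈u y∈st →
      Sum.[ across us xy x∈u , across ut xy x∈u ] (x∈p∪q⁻ (cluster s) (cluster t) y∈st)

  module _ (l r : BinTree n) (l#r : DisjointSubsets (cluster l) (cluster r)) where

    refines-left : ∀ {t} → Refines l t → Refines (node l tt r) t
    refines-left l≥t = record
      { connected = connected l≥t
      ; inside    = p⊆p∪q (cluster r) ∘ inside l≥t
      ; lca-≤     = λ xy x∈t y∈t → subst (λ h → _ ≤ ∣ cluster h ∣)
          (sym (lca-left l r (inside l≥t x∈t) (inside l≥t y∈t))) (lca-≤ l≥t xy x∈t y∈t)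
      }

    refines-right : ∀ {t} → Refines r t → Refines (node l tt r) t
    refines-right r≥t = record
      { connected = connected r≥t
      ; inside    = q⊆p∪q (cluster l) (cluster r) ∘ inside r≥t
      ; lca-≤     = λ xy x∈t y∈t → subst (λ h → _ ≤ ∣ cluster h ∣)
          (sym (lca-right l r (λ (x∈l , _) → l#r x∈l (inside r≥t x∈t))
                              (inside r≥t x∈t) (inside r≥t y∈t)))
          (lca-≤ r≥t xy x∈t y∈t)
      }

    lca-across : ∀ {x y} → Across l r x y → lca (node l tt r) x y ≡ node l tt r
    lca-across (inj₁ (x∈l , y∈r)) =
      lca-root l r (λ (_ , y∈l) → l#r y∈l y∈r) (λ (x∈r , _) → l#r x∈l x∈r)
    lca-across (inj₂ (x∈r , y∈l)) =
      lca-root l r (λ (x∈l , _) → l#r x∈l x∈r) (λ (_ , y∈r) → l#r y∈l y∈r)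

    refines-node : ∀ {s t} → Touching s t → JoinedAcross l r s t →
                   Refines (node l tt r) s → Refines (node l tt r) t →
                   Refines (node l tt r) (node s tt t)
    refines-node {s} {t} (a , b , a∈s , b∈t , ab) st h≥s h≥t = record
      { connected = connected-node
      ; inside    = inside-node
      ; lca-≤     = lca-≤-node
      }
      where
      connected-node : AllClustersConnected (node s tt t)
      connected-node here      = ∪-connected (cluster s) (cluster t)
        (connected h≥s here) (connected h≥t here) a∈s b∈t ab
      connected-node (left p)  = connected h≥s p
      connected-node (right p) = connected h≥t p

      inside-node : cluster (node s tt t) ⊆ cluster (node l tt r)
      inside-node x∈st with x∈p∪q⁻ (cluster s) (cluster t) x∈st
      ... | inj₁ x∈s = inside h≥s x∈s
      ... | inj₂ x∈t = inside h≥t x∈t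

      across-node : ∀ {x y} → Adj x y →
                    x ∈ cluster (node s tt t) → y ∈ cluster (node s tt t) →
                    ¬ (x ∈ cluster s × y ∈ cluster s) →
                    ¬ (x ∈ cluster t × y ∈ cluster t) → Across l r x y
      across-node xy x∈ y∈ ∉s ∉t
        with x∈p∪q⁻ (cluster s) (cluster t) x∈ | x∈p∪q⁻ (cluster s) (cluster t) y∈
      ... | inj₁ x∈s | inj₁ y∈s = ⊥-elim (∉s (x∈s , y∈s))
      ... | inj₁ x∈s | inj₂ y∈t = JoinedAcross.across st xy x∈s y∈t
      ... | inj₂ x∈t | inj₁ y∈s = JoinedAcross.across (joinedAcross-sym l r st) xy x∈t y∈s
      ... | inj₂ x∈t | inj₂ y∈t = ⊥-elim (∉t (x∈t , y∈t))

      lca-≤-node : ∀ {x y} → Adj x y →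
                   x ∈ cluster (node s tt t) → y ∈ cluster (node s tt t) →
                   ∣ cluster (lca (node s tt t) x y) ∣ ≤ ∣ cluster (lca (node l tt r) x y) ∣
      lca-≤-node {x} {y} xy x∈ y∈
        with (x ∈? cluster s) ×-dec (y ∈? cluster s) | (x ∈? cluster t) ×-dec (y ∈? cluster t)
      ... | yes (x∈s , y∈s) | _ rewrite lca-left s t x∈s y∈s = lca-≤ h≥s xy x∈s y∈s
      ... | no ∉s | yes (x∈t , y∈t) rewrite lca-right s t ∉s x∈t y∈t = lca-≤ h≥t xy x∈t y∈t
      ... | no ∉s | no ∉t
        rewrite lca-root s t ∉s ∉t | lca-across (across-node xy x∈ y∈ ∉s ∉t)
        = p⊆q⇒∣p∣≤∣q∣ inside-node

  forest-refines : ∀ h → Unique (Leaves.toList h) → All (Refines h) (forest h)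
  forest-refines (leaf v)     _   = record
    { connected = λ { here x∈ y∈ → subst (Star _ _)
        (trans (x∈⁅y⁆⇒x≡y v x∈) (sym (x∈⁅y⁆⇒x≡y v y∈))) ε }
    ; inside    = id
    ; lca-≤     = λ _ _ _ → ℕ.≤-refl
    } ∷ []
  forest-refines (node l _ r) lr!
    with l! , r! , l#r ← unique-node⁻ l r lr!
    = proj₁ (foldr-graft-invariant
        (joinedAcross-sym l r) (joinedAcross-node l r)
        (refines-node l r l#r)
        (forest l)
        (All.map (refines-left l r l#r) l≥)
        (All.map (refines-right l r l#r) r≥)
        (AllPairs.++⁺ (AllPairs.map vacuous (forest-separated l))
                      (AllPairs.map vacuous (forest-separated r))
                      (All.map (λ l≥s → All.map (λ r≥t → joined λ _ x∈s y∈t →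
                        inj₁ (inside l≥s x∈s , inside r≥t y∈t)) r≥) l≥)))
    where
    l≥ : All (Refines l) (forest l)
    l≥ = forest-refines l l!

    r≥ : All (Refines r) (forest r)
    r≥ = forest-refines r r!

    -- No edge joins two trees of the same child's forest.
    vacuous : ∀ {s t} → Separated s t → JoinedAcross l r s t
    vacuous s∥t = joined λ xy x∈s y∈t → ⊥-elim (s∥t (_ , _ , x∈s , y∈t , xy))

  -- Connected graphs have a single component

  -- The vertex only rules out the empty forest.
  separated⇒singleton : Connected → Fin n → ∀ F → leavesᶠ F ↭ allFin n →
                        AllPairs Separated F → ∃[ t ] F ≡ [ t ]
  separated⇒singleton conn v []       F↭ _ with () ← ∈-resp-↭ (↭-sym F↭) (∈-allFin v)
  separated⇒singleton conn v (t ∷ []) F↭ _ = t , refl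
  separated⇒singleton conn v (t ∷ s ∷ F) F↭ (t∥F ∷ _)
    with x , x∈t ← cluster-nonempty t
       | y , y∈s ← cluster-nonempty s
    = ⊥-elim (t#F ( ∈-cluster⇒∈-leaves t (stay (conn x y) x∈t)
                  , ∈-++⁺ˡ (∈-cluster⇒∈-leaves s y∈s)))
    where
    t#F : Disjoint (Leaves.toList t) (leavesᶠ (s ∷ F))
    t#F = proj₂ (proj₂ (unique-++⁻ (Leaves.toList t) (↭-allFin⇒unique F↭)))

    -- No edge leaves the cluster of t, so neither does a path.
    stay : ∀ {x y} → Star Adj x y → x ∈ cluster t → y ∈ cluster t
    stay ε                  x∈t = x∈t
    stay (_◅_ {j = z} xz p) x∈t
      with ∈-leavesᶠ⁻ (t ∷ s ∷ F) (∈-resp-↭ (↭-sym F↭) (∈-allFin z))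
    ... | _ , here refl , z∈t = stay p z∈t
    ... | u , there u∈F , z∈u =
      ⊥-elim (All.lookup t∥F u∈F (_ , z , x∈t , z∈u , xz))

-- Comparison of the costs

-- The sequence x is termwise at most y from some index on. Between the sequences
-- of two reals this is stronger than the order of the reals.
infix 4 _≼_

record _≼_ (x y : ℕ → ℚ) : Set where
  constructor eventually
  field termwise : ∃[ N ] (∀ i → N ≤ i → x i ℚ.≤ y i)

≼⇒≤ᵣ : ∀ x y → seq x ≼ seq y → x ≤ᵣ y
≼⇒≤ᵣ x y (eventually (N , x≤y)) δ 0<δ = N , λ i N≤i → begin
  seq x i         ≤⟨ x≤y i N≤i ⟩
  seq y i         ≡⟨ ℚ.+-identityʳ (seq y i) ⟨
  seq y i ℚ.+ 0ℚ  ≤⟨ ℚ.+-monoʳ-≤ (seq y i) (ℚ.<⇒≤ 0<δ) ⟩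
  seq y i ℚ.+ δ   ∎
  where open ℚ.≤-Reasoning

+-mono-≼ : ∀ {x y u v} → x ≼ y → u ≼ v → (λ i → x i ℚ.+ u i) ≼ (λ i → y i ℚ.+ v i)
+-mono-≼ (eventually (M , x≤y)) (eventually (N , u≤v)) =
  eventually (M ⊔ N , λ i ≤i → ℚ.+-mono-≤
    (x≤y i (ℕ.m⊔n≤o⇒m≤o M N ≤i)) (u≤v i (ℕ.m⊔n≤o⇒n≤o M N ≤i)))

·-nonNeg : ∀ k x {i} → 0ℚ ℚ.≤ seq x i → 0ℚ ℚ.≤ seq (k · x) i
·-nonNeg ℕ.zero  x 0≤x = ℚ.≤-refl
·-nonNeg (suc k) x 0≤x = ℚ.+-mono-≤ 0≤x (·-nonNeg k x 0≤x)

·-monoˡ-≤ : ∀ {m k} x {i} → 0ℚ ℚ.≤ seq x i → m ≤ k → seq (m · x) i ℚ.≤ seq (k · x) i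
·-monoˡ-≤ {k = k} x     0≤x z≤n       = ·-nonNeg k x 0≤x
·-monoˡ-≤         x {i} 0≤x (s≤s m≤k) = ℚ.+-monoʳ-≤ (seq x i) (·-monoˡ-≤ x 0≤x m≤k)

·-monoˡ-≼ : ∀ {m k} x → 0ᵣ <ᵣ x → m ≤ k → seq (m · x) ≼ seq (k · x)
·-monoˡ-≼ x (δ , 0<δ , N , δ≤x) m≤k = eventually (N , λ i N≤i → ·-monoˡ-≤ x
  (ℚ.≤-trans (ℚ.<⇒≤ 0<δ) (subst (ℚ._≤ seq x i) (ℚ.+-identityˡ δ) (δ≤x i N≤i))) m≤k)

module _ {n : ℕ} (G : WeightedGraph n) where
  open WeightedGraph G

  ∑ᴱ-mono-≼ : ∀ f g → (∀ x y → Adj x y → seq (f x y) ≼ seq (g x y)) →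
              seq (∑ᴱ f) ≼ seq (∑ᴱ g)
  ∑ᴱ-mono-≼ f g f≼g = go edges
    (all-filter (λ (x , y) → (x <? y) ×-dec adj? x y) (cartesianProduct (allFin n) (allFin n)))
    where
    go : ∀ es → All (λ (x , y) → x < y × Adj x y) es →
         seq (foldr _+ᵣ_ 0ᵣ (map (λ (x , y) → f x y) es)) ≼
         seq (foldr _+ᵣ_ 0ᵣ (map (λ (x , y) → g x y) es))
    go []             []             = eventually (0 , λ _ _ → ℚ.≤-refl)
    go ((x , y) ∷ es) ((_ , xy) ∷ p) = +-mono-≼ (f≼g x y xy) (go es p)

  ∑ᴱ-scaled-mono : (f g : Fin n → Fin n → ℕ) → (∀ x y → Adj x y → f x y ≤ g x y) →
                   ∑ᴱ (λ x y → f x y · w x y) ≤ᵣ ∑ᴱ (λ x y → g x y · w x y)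
  ∑ᴱ-scaled-mono f g f≤g = ≼⇒≤ᵣ (∑ᴱ fw) (∑ᴱ gw) (∑ᴱ-mono-≼ fw gw λ x y xy →
    ·-monoˡ-≼ {f x y} {g x y} (w x y) (w-pos xy) (f≤g x y xy))
    where
    fw gw : Fin n → Fin n → ℝ
    fw x y = f x y · w x y
    gw x y = g x y · w x y

lemma3 : (n : ℕ) → 2 ≤ n →
    (G : WeightedGraph n) → WeightedGraph.Connected G →
    (H : Hierarchy n) →
    ∃[ T ] ( ClustersConnected G T
    × ((x y : Fin n) → WeightedGraph.Adj G x y →
    ∣ Hierarchy.C T x y ∣ ≤ ∣ Hierarchy.C H x y ∣)
    × costD⁻ G T ≤ᵣ costD⁻ G H
    × costD G T ≤ᵣ costD G H )
lemma3 n@(suc _) _ G conn H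
  with t , eq ← separated⇒singleton G conn zero (forest G (Hierarchy.tree H))
         (↭-trans (forest-leaves G (Hierarchy.tree H)) (Hierarchy.leaves H))
         (forest-separated G (Hierarchy.tree H))
  = T , Refines.connected h≥t , C-≤
      , ∑ᴱ-scaled-mono G
          (λ x y → ∣ Hierarchy.C T x y ∣ ∸ 1) (λ x y → ∣ Hierarchy.C H x y ∣ ∸ 1)
          (λ x y xy → ℕ.∸-monoˡ-≤ 1 (C-≤ x y xy))
      , ∑ᴱ-scaled-mono G
          (λ x y → ∣ Hierarchy.C T x y ∣) (λ x y → ∣ Hierarchy.C H x y ∣) C-≤
  where
  open Hierarchy H using (leaves) renaming (tree to h)

  t↭ : Leaves.toList t ↭ allFin n
  t↭ = subst (_↭ allFin n)
    (trans (cong leavesᶠ eq) (++-identityʳ (Leaves.toList t)))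
    (↭-trans (forest-leaves G h) leaves)

  T : Hierarchy n
  T = record { tree = t ; leaves = t↭ }

  h≥t : Refines G h t
  h≥t = All.head (subst (All (Refines G h)) eq
    (forest-refines G h (↭-allFin⇒unique leaves)))

  t-spans : ∀ x → x ∈ cluster t
  t-spans x = ∈-leaves⇒∈-cluster t (∈-resp-↭ (↭-sym t↭) (∈-allFin x))

  C-≤ : ∀ x y → WeightedGraph.Adj G x y → ∣ Hierarchy.C T x y ∣ ≤ ∣ Hierarchy.C H x y ∣
  C-≤ x y xy = Refines.lca-≤ h≥t xy (t-spans x) (t-spans y)
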